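{- For all integers $n\ge 0$ the following hold: \begin{align*} M_{k}(0,2,2n) &> M_{k}(1,2,2n) && \text{for } k=2,3,4,\\ M_{k}(1,2,2n+1) &> M_{k}(0,2,2n+1) && \text{for } k=2,3,\\ M_{4}(0,2,2n+1) &= M_{4}(1,2,2n+1), &&\\ M_{k}(0,2,n) &> M_{k}(1,2,n) && \text{for every integer } k\ge 5. \end{align*}
   Context: A partition is a finite weakly decreasing (possibly empty) sequence of positive integers, called its parts; $\ell(\pi)$ denotes the number of parts of the partition $\pi$. For an integer $k\ge 2$, a $k$-colored partition of $n\ge 0$ is an ordered $k$-tuple $\overrightarrow{\pi}=(\pi^{(1)},\pi^{(2)},\dots,\pi^{(k)})$ of partitions (each possibly empty) such that the sum of all parts of all the $\pi^{(i)}$ equals $n$. Its $k$-crank is defined as $\ell(\pi^{(1)})-\ell(\pi^{(2)})$. For $m\in\mathbb{Z}$, $M_k(m,n)$ denotes the number of $k$-colored partitions of $n$ with $k$-crank equal to $m$; equivalently, $$\sum_{n\ge 0}\sum_{m\in\mathbb{Z}}M_k(m,n)z^mq^n=\frac{(q;q)_\infty^{2-k}}{(zq;q)_\infty(z^{ -1}q;q)_\infty},\qquad (a;q)_\infty:=\prod_{i\ge 0}(1-aq^i).$$ With three arguments, $M_k(r,m,n)$ denotes the number of $k$-colored partitions of $n$ whose $k$-crank is congruent to $r$ modulo $m$. -}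

module Defs where

open import Data.Empty using (⊥)
open import Data.Integer.Base using (ℤ; +_; _-_)
open import Data.Integer.Divisibility using (_∣_)
open import Data.List.Base using (List; []; _∷_; length; upTo; filter; cartesianProductWith)
open import Data.List.Membership.Propositional using (_∈_)
open import Data.List.Membership.Propositional.Properties
  using (∈-cartesianProductWith⁺; ∈-cartesianProductWith⁻; ∈-upTo⁺; ∈-filter⁺; ∈-filter⁻)
import Data.List.Properties as List
open import Data.List.Relation.Unary.All as All using (All; []; _∷_)
open import Data.List.Relation.Unary.Any using (here; there)
open import Data.List.Relation.Unary.Linked as Linked using (Linked)
open import Data.List.Relation.Unary.Unique.Propositional using (Unique; []; _∷_)
import Data.List.Relation.Unary.Unique.Propositional.Properties as Unique
open import Data.Nat.Base using (ℕ; zero; suc; _+_; _≤_; _≥_; _<_; s≤s; z≤n; NonTrivial)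
import Data.Nat.Divisibility as ℕ
open import Data.Nat.ListAction using (sum)
open import Data.Nat.Properties
  using (_≟_; _≥?_; _<?_; ≤-trans; ≤-reflexive; m≤m+n; m≤n+m; +-mono-≤)
open import Data.Product.Base using (_×_; _,_; proj₁; proj₂)
open import Data.Vec.Base as Vec using (Vec; []; _∷_)
import Data.Vec.Properties as Vec
open import Data.Vec.Relation.Unary.All as VecAll using ([]; _∷_)
open import Level using (0ℓ)
open import Relation.Binary.PropositionalEquality using (_≡_; refl)
open import Relation.Nullary.Decidable using (_×-dec_)
open import Relation.Unary using (Pred; Decidable)

IsPartition : Pred (List ℕ) 0ℓ
IsPartition π = Linked _≥_ π × All (0 <_) π

IsColoredPartition : (k n : ℕ) → Pred (Vec (List ℕ) k) 0ℓ
IsColoredPartition k n π = VecAll.All IsPartition π × Vec.sum (Vec.map sum π) ≡ n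

kCrank : (k : ℕ) .{{_ : NonTrivial k}} → Vec (List ℕ) k → ℤ
kCrank (suc (suc _)) (π₁ ∷ π₂ ∷ _) = + length π₁ - + length π₂

infix 4 _≡_mod_

_≡_mod_ : ℤ → ℤ → ℕ → Set
i ≡ j mod m = + m ∣ i - j

HasCrankResidue : (k : ℕ) .{{_ : NonTrivial k}} (r : ℤ) (m n : ℕ) → Pred (Vec (List ℕ) k) 0ℓ
HasCrankResidue k r m n π = IsColoredPartition k n π × (kCrank k π ≡ r mod m)

-- A repetition-free list of exactly the elements satisfying P. Any two such
-- lists have the same length, so the length of one counts these elements.
record Enumeration {A : Set} (P : Pred A 0ℓ) : Set where
  field
    elements : List A
    unique   : Unique elements
    sound    : ∀ {x} → x ∈ elements → P x
    complete : ∀ {x} → P x → x ∈ elements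

  size : ℕ
  size = length elements

isPartition? : Decidable IsPartition
isPartition? π = Linked.linked? _≥?_ π ×-dec All.all? (0 <?_) π

isColoredPartition? : ∀ k n → Decidable (IsColoredPartition k n)
isColoredPartition? k n π =
  VecAll.all? isPartition? π ×-dec (Vec.sum (Vec.map sum π) ≟ n)

hasCrankResidue? : ∀ k .{{_ : NonTrivial k}} r m n → Decidable (HasCrankResidue k r m n)
hasCrankResidue? k r m n π = isColoredPartition? k n π ×-dec (m ℕ.∣? _)

-- The lists of length at most l with entries at most b.
boundedLists : (b l : ℕ) → List (List ℕ)
boundedLists b zero    = [] ∷ []
boundedLists b (suc l) = [] ∷ cartesianProductWith _∷_ (upTo (suc b)) (boundedLists b l)

tuples : {A : Set} (k : ℕ) → List A → List (Vec A k)
tuples zero    xs = [] ∷ []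
tuples (suc k) xs = cartesianProductWith _∷_ xs (tuples k xs)

boundedLists-unique : ∀ b l → Unique (boundedLists b l)
boundedLists-unique b zero    = [] ∷ []
boundedLists-unique b (suc l) =
  All.tabulate nonempty ∷
  Unique.cartesianProductWith⁺ _∷_ List.∷-injective (Unique.upTo⁺ (suc b)) (boundedLists-unique b l)
  where
  nonempty : ∀ {xs} → xs ∈ cartesianProductWith _∷_ (upTo (suc b)) (boundedLists b l) → [] ≡ xs → ⊥
  nonempty xs∈ eq with ∈-cartesianProductWith⁻ _∷_ (upTo (suc b)) (boundedLists b l) xs∈
  nonempty xs∈ () | _ , _ , _ , _ , refl

tuples-unique : ∀ {A : Set} k {xs : List A} → Unique xs → Unique (tuples k xs)
tuples-unique zero    xs! = [] ∷ []
tuples-unique (suc k) xs! =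
  Unique.cartesianProductWith⁺ _∷_ Vec.∷-injective xs! (tuples-unique k xs!)

∈-boundedLists : ∀ {b l π} → All (_≤ b) π → length π ≤ l → π ∈ boundedLists b l
∈-boundedLists {l = zero}  []            _           = here refl
∈-boundedLists {l = suc l} []            _           = here refl
∈-boundedLists {l = suc l} (p≤b ∷ ps≤b) (s≤s len≤l) =
  there (∈-cartesianProductWith⁺ _∷_ (∈-upTo⁺ (s≤s p≤b)) (∈-boundedLists ps≤b len≤l))

∈-tuples : ∀ {A : Set} {k} {xs : List A} {v : Vec A k} → VecAll.All (_∈ xs) v → v ∈ tuples k xs
∈-tuples []            = here refl
∈-tuples (x∈xs ∷ v∈xs) = ∈-cartesianProductWith⁺ _∷_ x∈xs (∈-tuples v∈xs)

parts≤sum : ∀ π → All (_≤ sum π) π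
parts≤sum []      = []
parts≤sum (p ∷ π) =
  m≤m+n p (sum π) ∷ All.map (λ q≤ → ≤-trans q≤ (m≤n+m (sum π) p)) (parts≤sum π)

length≤sum : ∀ {π} → All (0 <_) π → length π ≤ sum π
length≤sum []           = z≤n
length≤sum (0<p ∷ 0<π) = +-mono-≤ 0<p (length≤sum 0<π)

partition-∈ : ∀ {n π} → IsPartition π → sum π ≤ n → π ∈ boundedLists n n
partition-∈ (_ , 0<π) ∑≤n =
  ∈-boundedLists (All.map (λ p≤ → ≤-trans p≤ ∑≤n) (parts≤sum _)) (≤-trans (length≤sum 0<π) ∑≤n)

partitions-∈ : ∀ {k n} {π : Vec (List ℕ) k} → VecAll.All IsPartition π →
               Vec.sum (Vec.map sum π) ≤ n → VecAll.All (_∈ boundedLists n n) π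
partitions-∈ []         _   = []
partitions-∈ (_∷_ {x = π₁} {xs = π} p ps) ∑≤n =
  partition-∈ p (≤-trans (m≤m+n (sum π₁) (Vec.sum (Vec.map sum π))) ∑≤n) ∷
  partitions-∈ ps (≤-trans (m≤n+m (Vec.sum (Vec.map sum π)) (sum π₁)) ∑≤n)

crankResidueClass : ∀ k .{{_ : NonTrivial k}} r m n → Enumeration (HasCrankResidue k r m n)
crankResidueClass k r m n = record
  { elements = filter P? candidates
  ; unique   = Unique.filter⁺ P? (tuples-unique k (boundedLists-unique n n))
  ; sound    = λ π∈ → proj₂ (∈-filter⁻ P? {xs = candidates} π∈)
  ; complete = λ { h@((ps , ∑≡n) , _) →
                   ∈-filter⁺ P? (∈-tuples (partitions-∈ ps (≤-reflexive ∑≡n))) h }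
  }
  where
  P?         = hasCrankResidue? k r m n
  candidates = tuples k (boundedLists n n)

M : (k : ℕ) .{{_ : NonTrivial k}} (r : ℤ) (m n : ℕ) → ℕ
M k r m n = Enumeration.size (crankResidueClass k r m n)

{-# OPTIONS --safe #-}

-- Counting k-colored partitions π of n with the sign (-1)^(ℓ(π⁽¹⁾) + ℓ(π⁽²⁾)), the parity of the crank,
-- gives M_k(0,2,n) - M_k(1,2,n), which is therefore the n-th coefficient of A² P^(k-2) with
-- A = ∏ 1/(1 + qⁱ) and P = ∏ 1/(1 - qⁱ). Put E = A P = ∏ 1/(1 - q²ⁱ); its even coefficients are positive
-- and its odd ones vanish. Euler's identity A = ∏ (1 - q²ⁱ⁻¹) shows that the n-th coefficient of A has
-- sign (-1)ⁿ or is 0. The cases k = 2, 3, 4 and k ≥ 5 are then read off from A², A E, E² and E² P^(k-4).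
-- To stay with finite products, parts are bounded by b = 2t ≥ n, where Euler's identity becomes
-- A = ∏_{i≤t} (1 - q²ⁱ⁻¹) · ∏_{t<i≤2t} 1/(1 - q²ⁱ).

module Submission where

open import Defs
import Algebra.Construct.Pointwise as Pointwise
import Algebra.Properties.AbelianGroup as AbelianGroupProperties
import Algebra.Properties.CommutativeSemigroup as CommutativeSemigroupProperties
import Algebra.Solver.Ring.NaturalCoefficients.Default as SemiringSolver
open import Algebra.Bundles using (CommutativeRing)
open import Data.Empty using (⊥)
open import Data.Integer.Base as ℤ using (ℤ; 0ℤ; 1ℤ; -1ℤ; +≤+; +<+)
import Data.Integer.Properties as ℤ
open import Data.List.Base using (List; []; _∷_; _++_; map; length; filter; cartesianProductWith)
open import Data.List.Membership.Propositional using (_∈_)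
open import Data.List.Membership.Propositional.Properties
  using (∈-cartesianProductWith⁺; ∈-cartesianProductWith⁻; ∈-filter⁺; ∈-filter⁻
        ; ∈-map⁺; ∈-map⁻; ∈-++⁺ˡ; ∈-++⁺ʳ; ∈-++⁻)
open import Data.List.Membership.Propositional.Properties.WithK using (unique∧set⇒bag)
import Data.List.Properties as List
open import Data.List.Relation.Binary.BagAndSetEquality using (∼bag⇒↭)
open import Data.List.Relation.Binary.Permutation.Propositional as ↭ using (_↭_)
open import Data.List.Relation.Unary.All as All using (All; []; _∷_)
open import Data.List.Relation.Unary.Any using (here; there)
open import Data.List.Relation.Unary.Linked as Linked using (Linked; []; [-]; _∷_)
open import Data.List.Relation.Unary.Linked.Properties using (Linked⇒All)
open import Data.List.Relation.Unary.Unique.Propositional using (Unique; []; _∷_)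
import Data.List.Relation.Unary.Unique.Propositional.Properties as Unique
open import Data.Nat.Base as ℕ using (ℕ; zero; suc; z≤n; s≤s; NonTrivial)
import Data.Nat.Divisibility as ℕ
open import Data.Nat.Induction using (<-rec)
open import Data.Nat.ListAction using (sum)
import Data.Nat.Properties as ℕ
open import Data.Product.Base using (_×_; _,_; proj₁; proj₂; ∃-syntax)
open import Data.Sum.Base as Sum using (_⊎_; inj₁; inj₂)
open import Data.Vec.Base as Vec using (Vec; []; _∷_; replicate)
import Data.Vec.Properties as Vec
open import Data.Vec.Relation.Unary.All as VecAll using ([]; _∷_)
open import Function.Base using (_∘_; case_of_)
open import Function.Bundles using (mk⇔)
open import Level using (0ℓ)
import Relation.Binary.Reasoning.Setoid as SetoidReasoning
open import Relation.Binary.PropositionalEquality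
  using (_≡_; _≢_; _≗_; refl; sym; trans; cong; cong₂; subst; module ≡-Reasoning)
open import Relation.Nullary.Decidable using (yes; no; _×-dec_)
open import Relation.Nullary.Negation using (¬_; contradiction)
open import Relation.Unary using (Pred; Decidable; _⊆_)

module ℤ+ = CommutativeSemigroupProperties ℤ.+-commutativeSemigroup
module ℤ* = CommutativeSemigroupProperties ℤ.*-commutativeSemigroup

-- Formal power series

module PowerSeries where

  open import Data.Integer.Base using (_+_; _*_; -_; _^_; _≤_; _<_)

  Series : Set
  Series = ℕ → ℤ

  infixl 6 _⊕_
  infixl 7 _⊛_

  _⊕_ : Series → Series → Series
  (f ⊕ g) n = f n + g n

  ⊖_ : Series → Series
  (⊖ f) n = - f n

  _·_ : ℤ → Series → Series
  (c · f) n = c * f n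

  𝟘 : Series
  𝟘 _ = 0ℤ

  X^_ : ℕ → Series
  (X^ zero)  zero    = 1ℤ
  (X^ zero)  (suc n) = 0ℤ
  (X^ suc m) zero    = 0ℤ
  (X^ suc m) (suc n) = (X^ m) n

  𝟙 : Series
  𝟙 = X^ 0

  -- The Cauchy product, recursive in the index and shifting the left factor: `(f ⊛ g) ∘ suc`
  -- unfolds to `(f 0 · (g ∘ suc)) ⊕ (f ∘ suc ⊛ g)`, so each ring law becomes an induction on the
  -- index.
  _⊛_ : Series → Series → Series
  (f ⊛ g) zero    = f 0 * g 0
  (f ⊛ g) (suc n) = f 0 * g (suc n) + (f ∘ suc ⊛ g) n

  ⊛-cong : ∀ {f f′ g g′} → f ≗ f′ → g ≗ g′ → f ⊛ g ≗ f′ ⊛ g′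
  ⊛-cong f≗ g≗ zero    = cong₂ _*_ (f≗ 0) (g≗ 0)
  ⊛-cong f≗ g≗ (suc n) =
    cong₂ _+_ (cong₂ _*_ (f≗ 0) (g≗ (suc n))) (⊛-cong (f≗ ∘ suc) g≗ n)

  ⊛-zeroˡ : ∀ g → 𝟘 ⊛ g ≗ 𝟘
  ⊛-zeroˡ g zero    = refl
  ⊛-zeroˡ g (suc n) = trans (ℤ.+-identityˡ _) (⊛-zeroˡ g n)

  ⊛-identityˡ : ∀ g → 𝟙 ⊛ g ≗ g
  ⊛-identityˡ g zero    = ℤ.*-identityˡ (g 0)
  ⊛-identityˡ g (suc n) =
    trans (cong₂ _+_ (ℤ.*-identityˡ (g (suc n))) (⊛-zeroˡ g n)) (ℤ.+-identityʳ (g (suc n)))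

  ⊛-distribʳ-⊕ : ∀ h f g → (f ⊕ g) ⊛ h ≗ f ⊛ h ⊕ g ⊛ h
  ⊛-distribʳ-⊕ h f g zero    = ℤ.*-distribʳ-+ (h 0) (f 0) (g 0)
  ⊛-distribʳ-⊕ h f g (suc n) =
    trans (cong₂ _+_ (ℤ.*-distribʳ-+ (h (suc n)) (f 0) (g 0)) (⊛-distribʳ-⊕ h (f ∘ suc) (g ∘ suc) n))
          (ℤ+.interchange (f 0 * h (suc n)) (g 0 * h (suc n)) _ _)

  ⊛-scaleˡ : ∀ c f g → (c · f) ⊛ g ≗ c · (f ⊛ g)
  ⊛-scaleˡ c f g zero    = ℤ.*-assoc c (f 0) (g 0)
  ⊛-scaleˡ c f g (suc n) =
    trans (cong₂ _+_ (ℤ.*-assoc c (f 0) (g (suc n))) (⊛-scaleˡ c (f ∘ suc) g n))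
          (sym (ℤ.*-distribˡ-+ c _ _))

  -- The mirror image of the defining clause, shifting the right factor instead; commutativity
  -- follows from comparing the two.
  ⊛-sucʳ : ∀ f g n → (f ⊛ g) (suc n) ≡ f (suc n) * g 0 + (f ⊛ g ∘ suc) n
  ⊛-sucʳ f g zero    = ℤ.+-comm (f 0 * g 1) (f 1 * g 0)
  ⊛-sucʳ f g (suc n) =
    trans (cong (f 0 * g (suc (suc n)) +_) (⊛-sucʳ (f ∘ suc) g n))
          (ℤ+.x∙yz≈y∙xz (f 0 * g (suc (suc n))) (f (suc (suc n)) * g 0) _)

  ⊛-comm : ∀ f g → f ⊛ g ≗ g ⊛ f
  ⊛-comm f g zero    = ℤ.*-comm (f 0) (g 0)
  ⊛-comm f g (suc n) =
    trans (cong₂ _+_ (ℤ.*-comm (f 0) (g (suc n))) (⊛-comm (f ∘ suc) g n)) (sym (⊛-sucʳ g f n))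

  ⊛-assoc : ∀ f g h → (f ⊛ g) ⊛ h ≗ f ⊛ (g ⊛ h)
  ⊛-assoc f g h zero    = ℤ.*-assoc (f 0) (g 0) (h 0)
  ⊛-assoc f g h (suc n) = begin
    f 0 * g 0 * h (suc n) + (((f 0 · (g ∘ suc)) ⊕ (f ∘ suc ⊛ g)) ⊛ h) n
      ≡⟨ cong₂ _+_ (ℤ.*-assoc (f 0) (g 0) _) (⊛-distribʳ-⊕ h (f 0 · (g ∘ suc)) (f ∘ suc ⊛ g) n) ⟩
    f 0 * (g 0 * h (suc n)) + (((f 0 · (g ∘ suc)) ⊛ h) n + ((f ∘ suc ⊛ g) ⊛ h) n)
      ≡⟨ ℤ.+-assoc (f 0 * (g 0 * h (suc n))) _ _ ⟨
    f 0 * (g 0 * h (suc n)) + ((f 0 · (g ∘ suc)) ⊛ h) n + ((f ∘ suc ⊛ g) ⊛ h) n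
      ≡⟨ cong₂ _+_ (cong (f 0 * (g 0 * h (suc n)) +_) (⊛-scaleˡ (f 0) (g ∘ suc) h n)) (⊛-assoc (f ∘ suc) g h n) ⟩
    f 0 * (g 0 * h (suc n)) + f 0 * (g ∘ suc ⊛ h) n + (f ∘ suc ⊛ (g ⊛ h)) n
      ≡⟨ cong (_+ (f ∘ suc ⊛ (g ⊛ h)) n) (ℤ.*-distribˡ-+ (f 0) (g 0 * h (suc n)) _) ⟨
    f 0 * (g ⊛ h) (suc n) + (f ∘ suc ⊛ (g ⊛ h)) n ∎
    where open ≡-Reasoning

  seriesRing : CommutativeRing 0ℓ 0ℓ
  seriesRing = record
    { Carrier           = Series
    ; _≈_               = _≗_
    ; _+_               = _⊕_
    ; _*_               = _⊛_
    ; -_                = ⊖_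
    ; 0#                = 𝟘
    ; 1#                = 𝟙
    ; isCommutativeRing = record
      { isRing = record
        { +-isAbelianGroup = Pointwise.isAbelianGroup ℕ ℤ.+-0-isAbelianGroup
        ; *-cong           = ⊛-cong
        ; *-assoc          = ⊛-assoc
        ; *-identity       = ⊛-identityˡ , λ f n → trans (⊛-comm f 𝟙 n) (⊛-identityˡ f n)
        ; distrib          =
            (λ f g h n → trans (⊛-comm f (g ⊕ h) n)
              (trans (⊛-distribʳ-⊕ f g h n) (cong₂ _+_ (⊛-comm g f n) (⊛-comm h f n))))
          , ⊛-distribʳ-⊕
        }
      ; *-comm = ⊛-comm
      }
    }

  X^-shift : ∀ m f n → (X^ m ⊛ f) (m ℕ.+ n) ≡ f n
  X^-shift zero    f n = ⊛-identityˡ f n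
  X^-shift (suc m) f n = trans (ℤ.+-identityˡ _) (X^-shift m f n)

  X^-shift-< : ∀ {m n} f → n ℕ.< m → (X^ m ⊛ f) n ≡ 0ℤ
  X^-shift-< {suc m} {zero}  f _         = refl
  X^-shift-< {suc m} {suc n} f (s≤s n<m) = trans (ℤ.+-identityˡ _) (X^-shift-< f n<m)

  X^-+ : ∀ m n → X^ m ⊛ X^ n ≗ X^ (m ℕ.+ n)
  X^-+ zero    n k       = ⊛-identityˡ (X^ n) k
  X^-+ (suc m) n zero    = refl
  X^-+ (suc m) n (suc k) = trans (ℤ.+-identityˡ _) (X^-+ m n k)

  X^-diag : ∀ m → (X^ m) m ≡ 1ℤ
  X^-diag zero    = refl
  X^-diag (suc m) = X^-diag m

  0≤-+ : ∀ {i j} → 0ℤ ≤ i → 0ℤ ≤ j → 0ℤ ≤ i + j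
  0≤-+ = ℤ.+-mono-≤

  0≤-* : ∀ {i j} → 0ℤ ≤ i → 0ℤ ≤ j → 0ℤ ≤ i * j
  0≤-* (+≤+ {n = m} _) (+≤+ {n = n} _) = subst (0ℤ ≤_) (ℤ.pos-* m n) (+≤+ z≤n)

  0<-* : ∀ {i j} → 0ℤ < i → 0ℤ < j → 0ℤ < i * j
  0<-* (+<+ {n = suc m} _) (+<+ {n = suc n} _) = +<+ (s≤s z≤n)

  ⊛-nonNeg : ∀ {f g} → (∀ n → 0ℤ ≤ f n) → (∀ n → 0ℤ ≤ g n) → ∀ n → 0ℤ ≤ (f ⊛ g) n
  ⊛-nonNeg 0≤f 0≤g zero    = 0≤-* (0≤f 0) (0≤g 0)
  ⊛-nonNeg 0≤f 0≤g (suc n) = 0≤-+ (0≤-* (0≤f 0) (0≤g (suc n))) (⊛-nonNeg (0≤f ∘ suc) 0≤g n)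

  ⊛-pos : ∀ {f g} → (∀ n → 0ℤ ≤ f n) → (∀ n → 0ℤ ≤ g n) →
          ∀ i j → 0ℤ < f i → 0ℤ < g j → 0ℤ < (f ⊛ g) (i ℕ.+ j)
  ⊛-pos 0≤f 0≤g zero    zero    0<f 0<g = 0<-* 0<f 0<g
  ⊛-pos 0≤f 0≤g zero    (suc j) 0<f 0<g =
    ℤ.+-mono-<-≤ (0<-* 0<f 0<g) (⊛-nonNeg (0≤f ∘ suc) 0≤g j)
  ⊛-pos 0≤f 0≤g (suc i) j       0<f 0<g =
    ℤ.+-mono-≤-< (0≤-* (0≤f 0) (0≤g (suc (i ℕ.+ j)))) (⊛-pos (0≤f ∘ suc) 0≤g i j 0<f 0<g)

  -- f(q) ↦ f(e q)
  twist : ℤ → Series → Series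
  twist e f n = e ^ n * f n

  -- The substitution q ↦ e q is a ring homomorphism. Statements about alternating signs thus reduce
  -- to statements about nonnegative coefficients.
  twist-⊛ : ∀ e f g → twist e (f ⊛ g) ≗ twist e f ⊛ twist e g
  twist-⊛ e f g zero    = ℤ*.interchange 1ℤ 1ℤ (f 0) (g 0)
  twist-⊛ e f g (suc n) = begin
    e * e ^ n * (f 0 * g (suc n) + (f ∘ suc ⊛ g) n)
      ≡⟨ ℤ.*-distribˡ-+ (e * e ^ n) _ _ ⟩
    e * e ^ n * (f 0 * g (suc n)) + e * e ^ n * (f ∘ suc ⊛ g) n
      ≡⟨ cong₂ _+_ (trans (ℤ*.x∙yz≈y∙xz (e * e ^ n) (f 0) (g (suc n)))
                          (cong (_* (e * e ^ n * g (suc n))) (sym (ℤ.*-identityˡ (f 0)))))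
                   (ℤ.*-assoc e (e ^ n) _) ⟩
    head + e * twist e (f ∘ suc ⊛ g) n
      ≡⟨ cong (head +_) (cong (e *_) (twist-⊛ e (f ∘ suc) g n)) ⟩
    head + e * (twist e (f ∘ suc) ⊛ twist e g) n
      ≡⟨ cong (head +_) (⊛-scaleˡ e (twist e (f ∘ suc)) (twist e g) n) ⟨
    head + ((e · twist e (f ∘ suc)) ⊛ twist e g) n
      ≡⟨ cong (head +_) (⊛-cong (λ m → sym (ℤ.*-assoc e (e ^ m) (f (suc m)))) (λ m → refl {x = twist e g m}) n) ⟩
    head + (twist e f ∘ suc ⊛ twist e g) n ∎
    where
    open ≡-Reasoning
    head : ℤ
    head = 1ℤ * f 0 * (e * e ^ n * g (suc n))

-- Truncated Euler products

module RecurrenceAlgebra {c ℓ} (R : CommutativeRing c ℓ) where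

  open CommutativeRing R renaming (refl to ≈-refl)
  open SetoidReasoning setoid
  open SemiringSolver commutativeSemiring using (solve; _:=_; _:+_; _:*_)

  -- If a′ = a/(1 + x) and p′ = p/(1 - x), then a′p′ = ap/(1 - x²).
  product-recurrence : ∀ {a a′ p p′ x y} → a′ + x * a′ ≈ a → p′ ≈ p + x * p′ → x * x ≈ y →
                       a′ * p′ ≈ a * p + y * (a′ * p′)
  product-recurrence {a} {a′} {p} {p′} {x} {y} a-rec p-rec x²≈y = begin
    a′ * p′                                ≈⟨ *-congˡ p-rec ⟩
    a′ * (p + x * p′)                      ≈⟨ *-congˡ (+-congˡ (*-congˡ p-rec)) ⟩
    a′ * (p + x * (p + x * p′))            ≈⟨ solve 4 (λ a′ p p′ x →
                                                a′ :* (p :+ x :* (p :+ x :* p′)) :=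
                                                (a′ :+ x :* a′) :* p :+ x :* x :* (a′ :* p′))
                                                ≈-refl a′ p p′ x ⟩
    (a′ + x * a′) * p + x * x * (a′ * p′)  ≈⟨ +-cong (*-congʳ a-rec) (*-congʳ x²≈y) ⟩
    a * p + y * (a′ * p′)                  ∎

  recurrence-solved : ∀ {f f′ x} → f′ ≈ f + x * f′ → (1# - x) * f′ ≈ f
  recurrence-solved {f} {f′} {x} rec = begin
    (1# - x) * f′               ≈⟨ distribʳ f′ 1# (- x) ⟩
    1# * f′ + - x * f′          ≈⟨ +-congʳ (*-identityˡ f′) ⟩
    f′ + - x * f′               ≈⟨ +-congʳ rec ⟩
    f + x * f′ + - x * f′       ≈⟨ +-assoc f (x * f′) (- x * f′) ⟩
    f + (x * f′ + - x * f′)     ≈⟨ +-congˡ (distribʳ f′ x (- x)) ⟨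
    f + (x - x) * f′            ≈⟨ +-congˡ (*-congʳ (-‿inverseʳ x)) ⟩
    f + 0# * f′                 ≈⟨ +-congˡ (zeroˡ f′) ⟩
    f + 0#                      ≈⟨ +-identityʳ f ⟩
    f                           ∎

  *-recurrence : ∀ g {f f′ x} → f′ ≈ f + x * f′ → g * f′ ≈ g * f + x * (g * f′)
  *-recurrence g {f} {f′} {x} rec = begin
    g * f′               ≈⟨ *-congˡ rec ⟩
    g * (f + x * f′)     ≈⟨ solve 4 (λ g f f′ x → g :* (f :+ x :* f′) := g :* f :+ x :* (g :* f′))
                              ≈-refl g f f′ x ⟩
    g * f + x * (g * f′) ∎

open PowerSeries
open RecurrenceAlgebra seriesRing
module 𝕊 = CommutativeRing seriesRing

-- At e = -1 the n-th coefficient has sign (-1)ⁿ or is 0; holding at e = 1 as well, it vanishes for odd n.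
record NonNeg (e : ℤ) (f : Series) : Set where
  constructor nonNeg
  field coeff≥0 : ∀ n → 0ℤ ℤ.≤ twist e f n

record PosAt (e : ℤ) (f : Series) (n : ℕ) : Set where
  constructor posAt
  field coeff>0 : 0ℤ ℤ.< twist e f n

open NonNeg
open PosAt

module _ {e : ℤ} where

  NonNeg-⊛ : ∀ {f g} → NonNeg e f → NonNeg e g → NonNeg e (f ⊛ g)
  NonNeg-⊛ {f} {g} (nonNeg 0≤f) (nonNeg 0≤g) =
    nonNeg λ n → subst (0ℤ ℤ.≤_) (sym (twist-⊛ e f g n)) (⊛-nonNeg 0≤f 0≤g n)

  PosAt-⊛ : ∀ {f g} → NonNeg e f → NonNeg e g → ∀ {i j} →
            PosAt e f i → PosAt e g j → PosAt e (f ⊛ g) (i ℕ.+ j)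
  PosAt-⊛ {f} {g} (nonNeg 0≤f) (nonNeg 0≤g) {i} {j} (posAt 0<f) (posAt 0<g) =
    posAt (subst (0ℤ ℤ.<_) (sym (twist-⊛ e f g (i ℕ.+ j))) (⊛-pos 0≤f 0≤g i j 0<f 0<g))

  NonNeg-resp : ∀ {f g} → f ≗ g → NonNeg e f → NonNeg e g
  NonNeg-resp f≗g (nonNeg 0≤f) = nonNeg λ n → subst (λ x → 0ℤ ℤ.≤ e ℤ.^ n ℤ.* x) (f≗g n) (0≤f n)

  PosAt-resp : ∀ {f g n} → f ≗ g → PosAt e f n → PosAt e g n
  PosAt-resp {n = n} f≗g (posAt 0<f) = posAt (subst (λ x → 0ℤ ℤ.< e ℤ.^ n ℤ.* x) (f≗g n) 0<f)

  NonNeg-𝟙 : NonNeg e 𝟙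
  NonNeg-𝟙 = nonNeg λ where
    zero    → +≤+ z≤n
    (suc n) → ℤ.≤-reflexive (sym (ℤ.*-zeroʳ (e ℤ.^ suc n)))

  PosAt-𝟙 : PosAt e 𝟙 0
  PosAt-𝟙 = posAt (+<+ (s≤s z≤n))

  module _ {m : ℕ} {f g : Series} (e^m≡1 : e ℤ.^ suc m ≡ 1ℤ)
           (f-rec : f ≗ g ⊕ X^ (suc m) ⊛ f) (g≥0 : NonNeg e g) where

    twist-below : ∀ {n} → n ℕ.< suc m → twist e f n ≡ twist e g n
    twist-below {n} n<m = cong (e ℤ.^ n ℤ.*_)
      (trans (f-rec n) (trans (cong (ℤ._+_ (g n)) (X^-shift-< f n<m)) (ℤ.+-identityʳ (g n))))

    -- Here f = g / (1 - q^(m+1)). Because e^(m+1) = 1, the twist does not see a shift by m+1, so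
    -- this division respects the sign pattern. For e = -1 this restricts the divisors to even
    -- exponents.
    twist-shift : ∀ k → twist e f (suc m ℕ.+ k) ≡ twist e g (suc m ℕ.+ k) ℤ.+ twist e f k
    twist-shift k = begin
      e ℤ.^ n ℤ.* f n
        ≡⟨ cong (e ℤ.^ n ℤ.*_) (trans (f-rec n) (cong (ℤ._+_ (g n)) (X^-shift (suc m) f k))) ⟩
      e ℤ.^ n ℤ.* (g n ℤ.+ f k)
        ≡⟨ ℤ.*-distribˡ-+ (e ℤ.^ n) (g n) (f k) ⟩
      twist e g n ℤ.+ e ℤ.^ n ℤ.* f k
        ≡⟨ cong (λ c → twist e g n ℤ.+ c ℤ.* f k) e^n≡e^k ⟩
      twist e g n ℤ.+ twist e f k ∎
      where
      open ≡-Reasoning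
      n : ℕ
      n = suc m ℕ.+ k
      e^n≡e^k : e ℤ.^ n ≡ e ℤ.^ k
      e^n≡e^k = trans (ℤ.^-distribˡ-+-* e (suc m) k)
                      (trans (cong (ℤ._* e ℤ.^ k) e^m≡1) (ℤ.*-identityˡ (e ℤ.^ k)))

    below-or-shift : ∀ n → n ℕ.< suc m ⊎ ∃[ k ] n ≡ suc m ℕ.+ k
    below-or-shift n with n ℕ.<? suc m
    ... | yes n<m = inj₁ n<m
    ... | no  n≮m = inj₂ (n ℕ.∸ suc m , sym (ℕ.m+[n∸m]≡n (ℕ.≮⇒≥ n≮m)))

    NonNeg-rec : NonNeg e f
    NonNeg-rec = nonNeg (<-rec (λ n → 0ℤ ℤ.≤ twist e f n) step)
      where
      -- The recurrence reaches back by a whole period `suc m`, hence the course-of-values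
      -- induction.
      step : ∀ n → (∀ {k} → k ℕ.< n → 0ℤ ℤ.≤ twist e f k) → 0ℤ ℤ.≤ twist e f n
      step n ih with below-or-shift n
      ... | inj₁ n<m        = subst (0ℤ ℤ.≤_) (sym (twist-below n<m)) (coeff≥0 g≥0 n)
      ... | inj₂ (k , refl) = subst (0ℤ ℤ.≤_) (sym (twist-shift k))
                                (0≤-+ (coeff≥0 g≥0 n) (ih (s≤s (ℕ.m≤n+m k m))))

    -- With no cancellation, a coefficient of f is positive as soon as one of its two summands is:
    -- the coefficient of g at the same index here, the coefficient of f one period earlier in
    -- `PosAt-shift`.
    PosAt-rec : ∀ {n} → PosAt e g n → PosAt e f n
    PosAt-rec {n} (posAt 0<g) with below-or-shift n
    ... | inj₁ n<m        = posAt (subst (0ℤ ℤ.<_) (sym (twist-below n<m)) 0<g)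
    ... | inj₂ (k , refl) = posAt (subst (0ℤ ℤ.<_) (sym (twist-shift k))
                              (ℤ.+-mono-<-≤ 0<g (coeff≥0 NonNeg-rec k)))

    PosAt-shift : ∀ {k} → PosAt e f k → PosAt e f (suc m ℕ.+ k)
    PosAt-shift {k} (posAt 0<f) = posAt (subst (0ℤ ℤ.<_) (sym (twist-shift k))
      (ℤ.+-mono-≤-< (coeff≥0 g≥0 (suc m ℕ.+ k)) 0<f))

-- Odd and even factors of Euler's product

1−X^ : ℕ → Series
1−X^ m = 𝟙 ⊕ ⊖ X^ m

X^-off-diag : ∀ {m n} → m ≢ n → (X^ m) n ≡ 0ℤ
X^-off-diag {zero}  {zero}  m≢n = contradiction refl m≢n
X^-off-diag {zero}  {suc n} m≢n = refl
X^-off-diag {suc m} {zero}  m≢n = refl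
X^-off-diag {suc m} {suc n} m≢n = X^-off-diag (m≢n ∘ cong suc)

m+m≡m*2 : ∀ m → m ℕ.+ m ≡ m ℕ.* 2
m+m≡m*2 m = trans (cong (m ℕ.+_) (sym (ℕ.+-identityʳ m))) (ℕ.*-comm 2 m)

X^-square : ∀ m → X^ m ⊛ X^ m ≗ X^ (m ℕ.* 2)
X^-square m n = trans (X^-+ m m n) (cong (λ k → (X^ k) n) (m+m≡m*2 m))

^-even : ∀ e → e ℤ.* e ≡ 1ℤ → ∀ n → e ℤ.^ (n ℕ.* 2) ≡ 1ℤ
^-even e e²≡1 zero    = refl
^-even e e²≡1 (suc n) =
  trans (sym (ℤ.*-assoc e e (e ℤ.^ (n ℕ.* 2)))) (cong₂ ℤ._*_ e²≡1 (^-even e e²≡1 n))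

-1^-odd : ∀ n → -1ℤ ℤ.^ suc (n ℕ.* 2) ≡ -1ℤ
-1^-odd n = cong (-1ℤ ℤ.*_) (^-even -1ℤ refl n)

PosAt-1−X^odd : ∀ t → PosAt -1ℤ (1−X^ (suc (t ℕ.* 2))) (suc (t ℕ.* 2))
PosAt-1−X^odd t = posAt (subst (0ℤ ℤ.<_) (sym eq) (+<+ (s≤s z≤n)))
  where
  eq : -1ℤ ℤ.^ suc (t ℕ.* 2) ℤ.* (0ℤ ℤ.+ ℤ.- (X^ (t ℕ.* 2)) (t ℕ.* 2)) ≡ 1ℤ
  eq = cong₂ (λ c x → c ℤ.* (0ℤ ℤ.+ ℤ.- x)) (-1^-odd t) (X^-diag (t ℕ.* 2))

PosAt-0-1−X^odd : ∀ t → PosAt -1ℤ (1−X^ (suc (t ℕ.* 2))) 0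
PosAt-0-1−X^odd t = posAt (+<+ (s≤s z≤n))

-- The only negative coefficient sits at an odd index, where the twist by -1 reverses it.
NonNeg-1−X^odd : ∀ t → NonNeg -1ℤ (1−X^ (suc (t ℕ.* 2)))
NonNeg-1−X^odd t = nonNeg 0≤coeff
  where
  0≤coeff : ∀ n → 0ℤ ℤ.≤ twist -1ℤ (1−X^ (suc (t ℕ.* 2))) n
  0≤coeff zero    = +≤+ z≤n
  0≤coeff (suc n) with t ℕ.* 2 ℕ.≟ n
  ... | yes refl = ℤ.<⇒≤ (coeff>0 (PosAt-1−X^odd t))
  ... | no  m≢n  = ℤ.≤-reflexive (sym
    (trans (cong (λ x → -1ℤ ℤ.^ suc n ℤ.* (0ℤ ℤ.+ ℤ.- x)) (X^-off-diag m≢n))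
           (ℤ.*-zeroʳ (-1ℤ ℤ.^ suc n))))

oddProduct : ℕ → Series
oddProduct zero    = 𝟙
oddProduct (suc t) = 1−X^ (suc (t ℕ.* 2)) ⊛ oddProduct t

evenProduct : ℕ → Series
evenProduct zero    = 𝟙
evenProduct (suc t) = 1−X^ (suc (suc (t ℕ.* 2))) ⊛ evenProduct t

NonNeg-oddProduct : ∀ t → NonNeg -1ℤ (oddProduct t)
NonNeg-oddProduct zero    = NonNeg-𝟙
NonNeg-oddProduct (suc t) = NonNeg-⊛ (NonNeg-1−X^odd t) (NonNeg-oddProduct t)

PosAt-0-oddProduct : ∀ t → PosAt -1ℤ (oddProduct t) 0
PosAt-0-oddProduct zero    = PosAt-𝟙
PosAt-0-oddProduct (suc t) =
  PosAt-⊛ (NonNeg-1−X^odd t) (NonNeg-oddProduct t) (PosAt-0-1−X^odd t) (PosAt-0-oddProduct t)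

-- The factor with exponent 2i+1 supplies its own power and every other factor its constant term;
-- since all twisted coefficients are nonnegative, nothing cancels this contribution.
PosAt-odd-oddProduct : ∀ {i t} → i ℕ.< t → PosAt -1ℤ (oddProduct t) (suc (i ℕ.* 2))
PosAt-odd-oddProduct {i} {suc t} (s≤s i≤t) with ℕ.m≤n⇒m<n∨m≡n i≤t
... | inj₁ i<t  =
  PosAt-⊛ (NonNeg-1−X^odd t) (NonNeg-oddProduct t) (PosAt-0-1−X^odd t) (PosAt-odd-oddProduct i<t)
... | inj₂ refl = subst (PosAt -1ℤ (oddProduct (suc t))) (ℕ.+-identityʳ (suc (t ℕ.* 2)))
  (PosAt-⊛ (NonNeg-1−X^odd t) (NonNeg-oddProduct t) (PosAt-1−X^odd t) (PosAt-0-oddProduct t))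

-- The hypotheses say that `A b` and `P b` are the products of 1/(1 + qⁱ) and of 1/(1 - qⁱ) over i ≤
-- b. Stating them as recurrences separates the algebra from the counting.
module Products (A P : ℕ → Series)
  (A₀ : A 0 ≗ 𝟙) (P₀ : P 0 ≗ 𝟙)
  (A-rec : ∀ b → A (suc b) ⊕ X^ (suc b) ⊛ A (suc b) ≗ A b)
  (P-rec : ∀ b → P (suc b) ≗ P b ⊕ X^ (suc b) ⊛ P (suc b))
  where

  open SemiringSolver 𝕊.commutativeSemiring using (solve; _:=_; _:*_)

  E : ℕ → Series
  E b = A b ⊛ P b

  E₀ : E 0 ≗ 𝟙
  E₀ n = trans (⊛-cong A₀ P₀ n) (⊛-identityˡ 𝟙 n)

  E-rec : ∀ b → E (suc b) ≗ E b ⊕ X^ (suc b ℕ.* 2) ⊛ E (suc b)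
  E-rec b = product-recurrence {A b} {A (suc b)} {P b} {P (suc b)} {X^ (suc b)}
              (A-rec b) (P-rec b) (X^-square (suc b))

  -- The odd and the even exponents together run through 1, ..., 2t, so the two finite products form
  -- the denominator of `P (t * 2)`. Each step in t cancels two factors.
  euler-inverse : ∀ t → (oddProduct t ⊛ evenProduct t) ⊛ P (t ℕ.* 2) ≗ 𝟙
  euler-inverse zero    n = trans (⊛-cong (⊛-identityˡ 𝟙) P₀ n) (⊛-identityˡ 𝟙 n)
  euler-inverse (suc t)   = begin
    (x ⊛ o ⊛ (y ⊛ v)) ⊛ P (suc (suc b))
      ≈⟨ solve 5 (λ x o y v p → x :* o :* (y :* v) :* p := o :* v :* (x :* (y :* p)))
           𝕊.refl x o y v (P (suc (suc b))) ⟩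
    (o ⊛ v) ⊛ (x ⊛ (y ⊛ P (suc (suc b))))
      -- The factor with the larger exponent is cancelled first, because `P-rec` only gives access
      -- to the largest admissible part.
      ≈⟨ 𝕊.*-congˡ {o ⊛ v} (𝕊.*-congˡ {x} (recurrence-solved {P (suc b)} (P-rec (suc b)))) ⟩
    (o ⊛ v) ⊛ (x ⊛ P (suc b))
      ≈⟨ 𝕊.*-congˡ {o ⊛ v} (recurrence-solved {P b} (P-rec b)) ⟩
    (o ⊛ v) ⊛ P b
      ≈⟨ euler-inverse t ⟩
    𝟙 ∎
    where
    open SetoidReasoning 𝕊.setoid
    b = t ℕ.* 2
    o = oddProduct t
    v = evenProduct t
    x = 1−X^ (suc b)
    y = 1−X^ (suc (suc b))

  evenProduct-inverse : ∀ t → evenProduct t ⊛ E t ≗ 𝟙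
  evenProduct-inverse zero    n = trans (⊛-identityˡ (E 0) n) (E₀ n)
  evenProduct-inverse (suc t)   = begin
    (y ⊛ v) ⊛ E (suc t)
      ≈⟨ solve 3 (λ y v p → y :* v :* p := v :* (y :* p)) 𝕊.refl y v (E (suc t)) ⟩
    v ⊛ (y ⊛ E (suc t))
      ≈⟨ 𝕊.*-congˡ {v} (recurrence-solved {E t} (E-rec t)) ⟩
    v ⊛ E t
      ≈⟨ evenProduct-inverse t ⟩
    𝟙 ∎
    where
    open SetoidReasoning 𝕊.setoid
    v = evenProduct t
    y = 1−X^ (suc (suc (t ℕ.* 2)))

  -- Insert 1 = o v P in front of A and recombine A P into E. The even product then cancels the
  -- first t factors of `E (t * 2)`, so that only those with t < i ≤ 2t survive.
  A-factorization : ∀ t → A (t ℕ.* 2) ≗ oddProduct t ⊛ (evenProduct t ⊛ E (t ℕ.* 2))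
  A-factorization t = begin
    A b                        ≈⟨ 𝕊.*-identityˡ (A b) ⟨
    𝟙 ⊛ A b                    ≈⟨ 𝕊.*-congʳ {A b} (euler-inverse t) ⟨
    ((o ⊛ v) ⊛ P b) ⊛ A b      ≈⟨ solve 4 (λ o v p a → o :* v :* p :* a := o :* (v :* (a :* p)))
                                    𝕊.refl o v (P b) (A b) ⟩
    o ⊛ (v ⊛ E b)              ∎
    where
    open SetoidReasoning 𝕊.setoid
    b = t ℕ.* 2
    o = oddProduct t
    v = evenProduct t

  module _ {e : ℤ} (e²≡1 : e ℤ.* e ≡ 1ℤ) where

    -- All exponents in `E-rec` are even, so one argument serves e = 1 and e = -1. Both signs
    -- together force the odd coefficients to vanish.
    NonNeg-E : ∀ b → NonNeg e (E b)
    NonNeg-E zero    = NonNeg-resp (λ n → sym (E₀ n)) NonNeg-𝟙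
    NonNeg-E (suc b) = NonNeg-rec (^-even e e²≡1 (suc b)) (E-rec b) (NonNeg-E b)

    -- The factor 1/(1 - q²), present once the bound is at least 1, already has every even
    -- coefficient equal to 1; the later factors preserve positivity.
    PosAt-E : ∀ b i → PosAt e (E (suc b)) (i ℕ.* 2)
    PosAt-E zero    zero    =
      PosAt-rec (^-even e e²≡1 1) (E-rec 0) (NonNeg-E 0) (PosAt-resp (λ n → sym (E₀ n)) PosAt-𝟙)
    PosAt-E zero    (suc i) =
      PosAt-shift (^-even e e²≡1 1) (E-rec 0) (NonNeg-E 0) (PosAt-E 0 i)
    PosAt-E (suc b) i       =
      PosAt-rec (^-even e e²≡1 (suc (suc b))) (E-rec (suc b)) (NonNeg-E (suc b)) (PosAt-E b i)

    module _ (t : ℕ) where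

      private
        -- The product of 1/(1 - q²ⁱ) over t < i ≤ s + t. The even product alone has coefficients of
        -- both signs, so it is kept together with E; induction on s starts at `G 0`, which is 1,
        -- and s = t gives the cofactor in `A-factorization`.
        G : ℕ → Series
        G s = evenProduct t ⊛ E (s ℕ.+ t)

        G-rec : ∀ s → G (suc s) ≗ G s ⊕ X^ (suc (s ℕ.+ t) ℕ.* 2) ⊛ G (suc s)
        G-rec s = *-recurrence (evenProduct t) {E (s ℕ.+ t)} (E-rec (s ℕ.+ t))

      NonNeg-evenProduct-E : ∀ s → NonNeg e (evenProduct t ⊛ E (s ℕ.+ t))
      NonNeg-evenProduct-E zero    = NonNeg-resp (λ n → sym (evenProduct-inverse t n)) NonNeg-𝟙
      NonNeg-evenProduct-E (suc s) =
        NonNeg-rec (^-even e e²≡1 (suc (s ℕ.+ t))) (G-rec s) (NonNeg-evenProduct-E s)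

      PosAt-evenProduct-E : ∀ s → PosAt e (evenProduct t ⊛ E (s ℕ.+ t)) 0
      PosAt-evenProduct-E zero    = PosAt-resp (λ n → sym (evenProduct-inverse t n)) PosAt-𝟙
      PosAt-evenProduct-E (suc s) =
        PosAt-rec (^-even e e²≡1 (suc (s ℕ.+ t))) (G-rec s) (NonNeg-evenProduct-E s) (PosAt-evenProduct-E s)

  NonNeg-A : ∀ t → NonNeg -1ℤ (A (t ℕ.* 2))
  NonNeg-A t = NonNeg-resp (λ n → sym (A-factorization t n))
    (NonNeg-⊛ (NonNeg-oddProduct t)
      (subst (λ b → NonNeg -1ℤ (evenProduct t ⊛ E b)) (m+m≡m*2 t) (NonNeg-evenProduct-E refl t t)))

  -- The cofactor of the odd product has a positive constant term and nonnegative twisted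
  -- coefficients, so a positive twisted coefficient survives at the same index.
  PosAt-A : ∀ t {n} → PosAt -1ℤ (oddProduct t) n → PosAt -1ℤ (A (t ℕ.* 2)) n
  PosAt-A t {n} 0<o = PosAt-resp (λ n → sym (A-factorization t n))
    (subst (PosAt -1ℤ _) (ℕ.+-identityʳ n)
      (PosAt-⊛ (NonNeg-oddProduct t)
        (subst (λ b → NonNeg -1ℤ (evenProduct t ⊛ E b)) (m+m≡m*2 t) (NonNeg-evenProduct-E refl t t))
        0<o
        (subst (λ b → PosAt -1ℤ (evenProduct t ⊛ E b) 0) (m+m≡m*2 t) (PosAt-evenProduct-E refl t t))))

  NonNeg-P : ∀ b → NonNeg 1ℤ (P b)
  NonNeg-P zero    = NonNeg-resp (λ n → sym (P₀ n)) NonNeg-𝟙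
  NonNeg-P (suc b) = NonNeg-rec (ℤ.^-zeroˡ (suc b)) (P-rec b) (NonNeg-P b)

  -- Already 1/(1 - q) has all its coefficients equal to 1.
  PosAt-P : ∀ b n → PosAt 1ℤ (P (suc b)) n
  PosAt-P zero    zero    =
    PosAt-rec refl (P-rec 0) (NonNeg-P 0) (PosAt-resp (λ n → sym (P₀ n)) PosAt-𝟙)
  PosAt-P zero    (suc n) = PosAt-shift refl (P-rec 0) (NonNeg-P 0) (PosAt-P 0 n)
  PosAt-P (suc b) n       =
    PosAt-rec (ℤ.^-zeroˡ (suc (suc b))) (P-rec (suc b)) (NonNeg-P (suc b)) (PosAt-P b n)

-- Signed enumeration

open import Data.Integer.Base using (+_; -[1+_]; ∣_∣)

open Enumeration

private
  variable
    S T U : Set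

total : (S → ℤ) → List S → ℤ
total w []       = 0ℤ
total w (x ∷ xs) = w x ℤ.+ total w xs

total-++ : (w : S → ℤ) → ∀ xs ys → total w (xs ++ ys) ≡ total w xs ℤ.+ total w ys
total-++ w []       ys = sym (ℤ.+-identityˡ _)
total-++ w (x ∷ xs) ys =
  trans (cong (ℤ._+_ (w x)) (total-++ w xs ys)) (sym (ℤ.+-assoc (w x) (total w xs) (total w ys)))

total-map : (w : T → ℤ) (f : S → T) → ∀ xs → total w (map f xs) ≡ total (w ∘ f) xs
total-map w f []       = refl
total-map w f (x ∷ xs) = cong (ℤ._+_ (w (f x))) (total-map w f xs)

total-scale : ∀ c {v w : S → ℤ} → (∀ x → w x ≡ c ℤ.* v x) → ∀ xs → total w xs ≡ c ℤ.* total v xs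
total-scale c w≡cv []       = sym (ℤ.*-zeroʳ c)
total-scale c w≡cv (x ∷ xs) =
  trans (cong₂ ℤ._+_ (w≡cv x) (total-scale c w≡cv xs)) (sym (ℤ.*-distribˡ-+ c _ _))

total-const : (w : S → ℤ) → ∀ {c xs} → (∀ {x} → x ∈ xs → w x ≡ c) → total w xs ≡ + length xs ℤ.* c
total-const w {c} {[]}     w≡c = refl
total-const w {c} {x ∷ xs} w≡c = trans (cong₂ ℤ._+_ (w≡c (here refl)) (total-const w (w≡c ∘ there)))
                                  (sym (ℤ.suc-* (+ length xs) c))

total-cartesianProductWith : (w : U → ℤ) (u : S → ℤ) (v : T → ℤ) (f : S → T → U) →
  (∀ x y → w (f x y) ≡ u x ℤ.* v y) →
  ∀ xs ys → total w (cartesianProductWith f xs ys) ≡ total u xs ℤ.* total v ys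
total-cartesianProductWith w u v f w-mult []       ys = refl
total-cartesianProductWith w u v f w-mult (x ∷ xs) ys = begin
  total w (map (f x) ys ++ cartesianProductWith f xs ys)
    ≡⟨ total-++ w (map (f x) ys) _ ⟩
  total w (map (f x) ys) ℤ.+ total w (cartesianProductWith f xs ys)
    ≡⟨ cong₂ ℤ._+_ (trans (total-map w (f x) ys) (total-scale (u x) (w-mult x) ys))
                   (total-cartesianProductWith w u v f w-mult xs ys) ⟩
  u x ℤ.* total v ys ℤ.+ total u xs ℤ.* total v ys
    ≡⟨ ℤ.*-distribʳ-+ (total v ys) (u x) (total u xs) ⟨
  (u x ℤ.+ total u xs) ℤ.* total v ys ∎
  where open ≡-Reasoning

total-↭ : (w : S → ℤ) → ∀ {xs ys} → xs ↭ ys → total w xs ≡ total w ys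
total-↭ w ↭.refl          = refl
total-↭ w (↭.prep x p)    = cong (ℤ._+_ (w x)) (total-↭ w p)
total-↭ w {x ∷ y ∷ xs} (↭.swap _ _ p) =
  trans (ℤ+.x∙yz≈y∙xz (w x) (w y) (total w xs))
        (cong (ℤ._+_ (w y)) (cong (ℤ._+_ (w x)) (total-↭ w p)))
total-↭ w (↭.trans p q)   = trans (total-↭ w p) (total-↭ w q)

weigh : {P : Pred S 0ℓ} → (S → ℤ) → Enumeration P → ℤ
weigh w e = total w (elements e)

-- Two repetition-free lists with the same members are permutations of each other. Every counting
-- identity below therefore reduces to an equivalence of predicates.
weigh-cong : (w : S → ℤ) {P Q : Pred S 0ℓ} → P ⊆ Q → Q ⊆ P →
             (e : Enumeration P) (e′ : Enumeration Q) → weigh w e ≡ weigh w e′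
weigh-cong w P⊆Q Q⊆P e e′ = total-↭ w (∼bag⇒↭ (unique∧set⇒bag (unique e) (unique e′)
  (mk⇔ (complete e′ ∘ P⊆Q ∘ sound e) (complete e ∘ Q⊆P ∘ sound e′))))

∅-enumeration : Enumeration {S} (λ _ → ⊥)
∅-enumeration = record { elements = [] ; unique = [] ; sound = λ () ; complete = λ () }

singleton-enumeration : (x : S) → Enumeration (_≡ x)
singleton-enumeration x = record
  { elements = x ∷ []
  ; unique   = [] ∷ []
  ; sound    = λ { (here y≡x) → y≡x }
  ; complete = here
  }

∪-enumeration : {P Q : Pred S 0ℓ} → (∀ {x} → P x → Q x → ⊥) →
                Enumeration P → Enumeration Q → Enumeration (λ x → P x ⊎ Q x)
∪-enumeration P∩Q=∅ e e′ = record
  { elements = elements e ++ elements e′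
  ; unique   = Unique.++⁺ (unique e) (unique e′) λ (x∈e , x∈e′) → P∩Q=∅ (sound e x∈e) (sound e′ x∈e′)
  ; sound    = λ x∈ → case ∈-++⁻ (elements e) x∈ of λ where
      (inj₁ x∈e)  → inj₁ (sound e x∈e)
      (inj₂ x∈e′) → inj₂ (sound e′ x∈e′)
  ; complete = λ where
      (inj₁ p) → ∈-++⁺ˡ (complete e p)
      (inj₂ q) → ∈-++⁺ʳ (elements e) (complete e′ q)
  }

image-enumeration : {P : Pred S 0ℓ} (f : S → T) → (∀ {x y} → f x ≡ f y → x ≡ y) →
                    Enumeration P → Enumeration (λ y → ∃[ x ] P x × y ≡ f x)
image-enumeration f f-inj e = record
  { elements = map f (elements e)
  ; unique   = Unique.map⁺ f-inj (unique e)
  ; sound    = λ y∈ → case ∈-map⁻ f y∈ of λ (x , x∈ , y≡fx) → x , sound e x∈ , y≡fx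
  ; complete = λ { (x , p , refl) → ∈-map⁺ f (complete e p) }
  }

module Convolution {S T U : Set} (f : S → T → U) where

  -- The recursion copies that of `_⊛_`, so that `total-convolve` turns it into a Cauchy product
  -- clause by clause.
  convolve : (ℕ → List S) → (ℕ → List T) → ℕ → List U
  convolve L K zero    = cartesianProductWith f (L 0) (K 0)
  convolve L K (suc n) = cartesianProductWith f (L 0) (K (suc n)) ++ convolve (L ∘ suc) K n

  ∈-convolve⁺ : ∀ {L K x y} i j → x ∈ L i → y ∈ K j → f x y ∈ convolve L K (i ℕ.+ j)
  ∈-convolve⁺ zero    zero    x∈ y∈ = ∈-cartesianProductWith⁺ f x∈ y∈
  ∈-convolve⁺ zero    (suc j) x∈ y∈ = ∈-++⁺ˡ (∈-cartesianProductWith⁺ f x∈ y∈)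
  ∈-convolve⁺ (suc i) j       x∈ y∈ = ∈-++⁺ʳ _ (∈-convolve⁺ i j x∈ y∈)

  ∈-convolve⁻ : ∀ L K n {z} → z ∈ convolve L K n →
                ∃[ i ] ∃[ j ] ∃[ x ] ∃[ y ] x ∈ L i × y ∈ K j × i ℕ.+ j ≡ n × z ≡ f x y
  ∈-convolve⁻ L K zero    z∈ with ∈-cartesianProductWith⁻ f (L 0) (K 0) z∈
  ... | x , y , x∈ , y∈ , z≡ = 0 , 0 , x , y , x∈ , y∈ , refl , z≡
  ∈-convolve⁻ L K (suc n) z∈ with ∈-++⁻ (cartesianProductWith f (L 0) (K (suc n))) z∈
  ... | inj₁ z∈ˡ with ∈-cartesianProductWith⁻ f (L 0) (K (suc n)) z∈ˡ
  ...   | x , y , x∈ , y∈ , z≡ = 0 , suc n , x , y , x∈ , y∈ , refl , z≡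
  ∈-convolve⁻ L K (suc n) z∈ | inj₂ z∈ʳ with ∈-convolve⁻ (L ∘ suc) K n z∈ʳ
  ...   | i , j , x , y , x∈ , y∈ , i+j≡n , z≡ = suc i , j , x , y , x∈ , y∈ , cong suc i+j≡n , z≡

  convolve-unique : (∀ {x y x′ y′} → f x y ≡ f x′ y′ → x ≡ x′ × y ≡ y′) →
    ∀ {L K} → (∀ {i j x} → x ∈ L i → x ∈ L j → i ≡ j) →
    (∀ i → Unique (L i)) → (∀ j → Unique (K j)) → ∀ n → Unique (convolve L K n)
  convolve-unique f-inj L-disjoint L! K! zero    = Unique.cartesianProductWith⁺ f f-inj (L! 0) (K! 0)
  convolve-unique f-inj {L} {K} L-disjoint L! K! (suc n) =
    Unique.++⁺ (Unique.cartesianProductWith⁺ f f-inj (L! 0) (K! (suc n)))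
               (convolve-unique f-inj (λ x∈ x∈′ → ℕ.suc-injective (L-disjoint x∈ x∈′)) (L! ∘ suc) K! n)
               disjoint
    where
    disjoint : ∀ {z} → ¬ (z ∈ cartesianProductWith f (L 0) (K (suc n)) × z ∈ convolve (L ∘ suc) K n)
    disjoint (z∈ˡ , z∈ʳ)
      with ∈-cartesianProductWith⁻ f (L 0) (K (suc n)) z∈ˡ | ∈-convolve⁻ (L ∘ suc) K n z∈ʳ
    ... | x , y , x∈ , _ , refl | i , j , x′ , y′ , x′∈ , _ , _ , eq with f-inj eq
    ...   | refl , _ with L-disjoint x∈ x′∈
    ...     | ()

  total-convolve : (w : U → ℤ) (u : S → ℤ) (v : T → ℤ) → (∀ x y → w (f x y) ≡ u x ℤ.* v y) →
    ∀ L K → total w ∘ convolve L K ≗ (total u ∘ L) ⊛ (total v ∘ K)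
  total-convolve w u v w-mult L K zero    = total-cartesianProductWith w u v f w-mult (L 0) (K 0)
  total-convolve w u v w-mult L K (suc n) =
    trans (total-++ w (cartesianProductWith f (L 0) (K (suc n))) (convolve (L ∘ suc) K n))
          (cong₂ ℤ._+_ (total-cartesianProductWith w u v f w-mult (L 0) (K (suc n)))
                       (total-convolve w u v w-mult (L ∘ suc) K n))

-- Generating functions of partitions with bounded parts

BoundedPartition : ℕ → Pred (List ℕ) 0ℓ
BoundedPartition b π = IsPartition π × All (ℕ._≤ b) π

BoundedPartitionOf : (b n : ℕ) → Pred (List ℕ) 0ℓ
BoundedPartitionOf b n π = BoundedPartition b π × sum π ≡ n

boundedPartitionsOf : ∀ b n → Enumeration (BoundedPartitionOf b n)
boundedPartitionsOf b n = record
  { elements = filter P? (boundedLists n n)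
  ; unique   = Unique.filter⁺ P? (boundedLists-unique n n)
  ; sound    = λ π∈ → proj₂ (∈-filter⁻ P? {xs = boundedLists n n} π∈)
  ; complete = λ h@((π-partition , _) , ∑≡n) →
                 ∈-filter⁺ P? (partition-∈ π-partition (ℕ.≤-reflexive ∑≡n)) h
  }
  where
  P? : Decidable (BoundedPartitionOf b n)
  P? π = (isPartition? π ×-dec All.all? (ℕ._≤? b) π) ×-dec (sum π ℕ.≟ n)

module _ (ε : ℤ) where

  lengthWeight : List ℕ → ℤ
  lengthWeight π = ε ℤ.^ length π

  -- The product of 1/(1 - ε qⁱ) over i ≤ b, obtained by counting partitions with a factor `ε` per
  -- part.
  partitionSeries : ℕ → Series
  partitionSeries b n = weigh lengthWeight (boundedPartitionsOf b n)

  partitionSeries-0 : partitionSeries 0 ≗ 𝟙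
  partitionSeries-0 zero    =
    weigh-cong lengthWeight only-[] (λ { refl → (([] , []) , []) , refl })
      (boundedPartitionsOf 0 0) (singleton-enumeration [])
    where
    only-[] : BoundedPartitionOf 0 0 ⊆ (_≡ [])
    only-[] {[]}    _ = refl
    only-[] {p ∷ π} (((_ , 0<p ∷ _) , p≤0 ∷ _) , _) = contradiction p≤0 (ℕ.<⇒≱ 0<p)
  partitionSeries-0 (suc n) =
    weigh-cong lengthWeight none (λ ()) (boundedPartitionsOf 0 (suc n)) ∅-enumeration
    where
    none : BoundedPartitionOf 0 (suc n) ⊆ λ _ → ⊥
    none {p ∷ π} (((_ , 0<p ∷ _) , p≤0 ∷ _) , _) = contradiction p≤0 (ℕ.<⇒≱ 0<p)

  -- Split by whether `suc b` is a part. Parts decrease, so it can only come first; removing one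
  -- copy leaves a partition of n - (b+1) under the same bound and costs one factor `ε`.
  partitionSeries-suc : ∀ b → partitionSeries (suc b) ≗
                        partitionSeries b ⊕ (ε · (X^ (suc b) ⊛ partitionSeries (suc b)))
  partitionSeries-suc b n with n ℕ.<? suc b
  -- For n ≤ b no part can be as large as `suc b`, and the shifted series contributes 0.
  ... | yes n≤b = begin
    partitionSeries (suc b) n
      ≡⟨ weigh-cong lengthWeight shrink enlarge (boundedPartitionsOf (suc b) n) (boundedPartitionsOf b n) ⟩
    partitionSeries b n
      ≡⟨ ℤ.+-identityʳ _ ⟨
    partitionSeries b n ℤ.+ 0ℤ
      ≡⟨ cong (ℤ._+_ (partitionSeries b n)) (trans (cong (ε ℤ.*_) (X^-shift-< _ n≤b)) (ℤ.*-zeroʳ ε)) ⟨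
    (partitionSeries b ⊕ (ε · (X^ (suc b) ⊛ partitionSeries (suc b)))) n ∎
    where
    open ≡-Reasoning
    shrink : BoundedPartitionOf (suc b) n ⊆ BoundedPartitionOf b n
    shrink {π} ((π-partition , _) , refl) =
      (π-partition , All.map (λ p≤ → ℕ.≤-trans p≤ (ℕ.s≤s⁻¹ n≤b)) (parts≤sum π)) , refl
    enlarge : BoundedPartitionOf b n ⊆ BoundedPartitionOf (suc b) n
    enlarge ((π-partition , π≤b) , ∑≡n) = (π-partition , All.map ℕ.m≤n⇒m≤1+n π≤b) , ∑≡n
  ... | no n≰b with n ℕ.∸ suc b | ℕ.m+[n∸m]≡n (ℕ.≮⇒≥ n≰b)
  ...   | k | refl = begin
    partitionSeries (suc b) (suc b ℕ.+ k)
      ≡⟨ weigh-cong lengthWeight split join (boundedPartitionsOf (suc b) (suc b ℕ.+ k))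
           (∪-enumeration disjoint (boundedPartitionsOf b (suc b ℕ.+ k))
             (image-enumeration (suc b ∷_) List.∷-injectiveʳ (boundedPartitionsOf (suc b) k))) ⟩
    total lengthWeight (elements (boundedPartitionsOf b (suc b ℕ.+ k)) ++
                        map (suc b ∷_) (elements (boundedPartitionsOf (suc b) k)))
      ≡⟨ total-++ lengthWeight (elements (boundedPartitionsOf b (suc b ℕ.+ k))) _ ⟩
    partitionSeries b (suc b ℕ.+ k) ℤ.+
      total lengthWeight (map (suc b ∷_) (elements (boundedPartitionsOf (suc b) k)))
      ≡⟨ cong (ℤ._+_ (partitionSeries b (suc b ℕ.+ k)))
           (trans (total-map lengthWeight (suc b ∷_) (elements (boundedPartitionsOf (suc b) k)))
                  (total-scale ε (λ _ → refl) (elements (boundedPartitionsOf (suc b) k)))) ⟩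
    partitionSeries b (suc b ℕ.+ k) ℤ.+ ε ℤ.* partitionSeries (suc b) k
      ≡⟨ cong (λ x → partitionSeries b (suc b ℕ.+ k) ℤ.+ ε ℤ.* x)
           (X^-shift (suc b) (partitionSeries (suc b)) k) ⟨
    (partitionSeries b ⊕ (ε · (X^ (suc b) ⊛ partitionSeries (suc b)))) (suc b ℕ.+ k) ∎
    where
    open ≡-Reasoning
    WithPart : Pred (List ℕ) 0ℓ
    WithPart π = ∃[ ρ ] BoundedPartitionOf (suc b) k ρ × π ≡ suc b ∷ ρ

    disjoint : ∀ {π} → BoundedPartitionOf b (suc b ℕ.+ k) π → WithPart π → ⊥
    disjoint ((_ , 1+b≤b ∷ _) , _) (_ , _ , refl) = ℕ.<-irrefl refl 1+b≤b

    split : ∀ {π} → BoundedPartitionOf (suc b) (suc b ℕ.+ k) π →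
            BoundedPartitionOf b (suc b ℕ.+ k) π ⊎ WithPart π
    split {p ∷ π} (((desc , 0<p ∷ 0<π) , p≤ ∷ π≤) , ∑≡) with ℕ.m≤n⇒m<n∨m≡n p≤
    -- The first part is the largest, so its bound passes to all the others.
    ... | inj₁ p<1+b = inj₁ (((desc , 0<p ∷ 0<π) ,
      Linked⇒All (λ x≥y y≥z → ℕ.≤-trans y≥z x≥y) (ℕ.s≤s⁻¹ p<1+b) desc) , ∑≡)
    ... | inj₂ refl  = inj₂ (π , (((Linked.tail desc , 0<π) , π≤) , ℕ.+-cancelˡ-≡ (suc b) (sum π) k ∑≡) , refl)

    join : ∀ {π} → BoundedPartitionOf b (suc b ℕ.+ k) π ⊎ WithPart π →
           BoundedPartitionOf (suc b) (suc b ℕ.+ k) π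
    join (inj₁ ((π-partition , π≤b) , ∑≡)) = (π-partition , All.map ℕ.m≤n⇒m≤1+n π≤b) , ∑≡
    join (inj₂ (ρ , (((desc , 0<ρ) , ρ≤) , refl) , refl)) =
      ((cons ρ≤ desc , s≤s z≤n ∷ 0<ρ) , ℕ.≤-refl ∷ ρ≤) , refl
      where
      cons : ∀ {ρ} → All (ℕ._≤ suc b) ρ → Linked ℕ._≥_ ρ → Linked ℕ._≥_ (suc b ∷ ρ)
      cons []       []   = [-]
      cons (r≤ ∷ _) desc = r≤ ∷ desc

-- Colored partitions with one sign per color

BoundedColoredPartition : (b k n : ℕ) → Pred (Vec (List ℕ) k) 0ℓ
BoundedColoredPartition b k n π =
  VecAll.All (BoundedPartition b) π × Vec.sum (Vec.map sum π) ≡ n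

colorWeight : ∀ {k} → Vec ℤ k → Vec (List ℕ) k → ℤ
colorWeight []       []      = 1ℤ
colorWeight (ε ∷ εs) (π ∷ πs) = lengthWeight ε π ℤ.* colorWeight εs πs

-- Built color by color as a convolution rather than by filtering, so that the total weight factors
-- into one series per color.
boundedColoredPartitions : ∀ b k n → Enumeration (BoundedColoredPartition b k n)
boundedColoredPartitions b zero    zero    = record
  { elements = [] ∷ []
  ; unique   = [] ∷ []
  ; sound    = λ { (here refl) → [] , refl }
  ; complete = λ { {[]} _ → here refl }
  }
boundedColoredPartitions b zero    (suc n) = record
  { elements = [] ; unique = [] ; sound = λ () ; complete = λ { {[]} () } }
boundedColoredPartitions b (suc k) n       = record
  { elements = convolve L K n
  ; unique   = convolve-unique Vec.∷-injective
      (λ {i} {j} π∈ π∈′ → trans (sym (proj₂ (sound (boundedPartitionsOf b i) π∈)))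
                                (proj₂ (sound (boundedPartitionsOf b j) π∈′)))
      (λ i → unique (boundedPartitionsOf b i)) (λ j → unique (boundedColoredPartitions b k j)) n
  ; sound    = sound-convolve
  ; complete = λ { {π ∷ πs} ((p ∷ ps) , refl) →
      ∈-convolve⁺ (sum π) _ (complete (boundedPartitionsOf b _) (p , refl))
                  (complete (boundedColoredPartitions b k _) (ps , refl)) }
  }
  where
  open Convolution {U = Vec (List ℕ) (suc k)} _∷_
  L : ℕ → List (List ℕ)
  L i = elements (boundedPartitionsOf b i)
  K : ℕ → List (Vec (List ℕ) k)
  K j = elements (boundedColoredPartitions b k j)
  sound-convolve : ∀ {πs} → πs ∈ convolve L K n → BoundedColoredPartition b (suc k) n πs
  sound-convolve πs∈ with ∈-convolve⁻ L K n πs∈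
  ... | i , j , π , πs , π∈ , πs∈ , refl , refl
    with sound (boundedPartitionsOf b i) π∈ | sound (boundedColoredPartitions b k j) πs∈
  ... | p , refl | ps , refl = p ∷ ps , refl

coloredSeries : ∀ {k} → ℕ → Vec ℤ k → Series
coloredSeries b []       = 𝟙
coloredSeries b (ε ∷ εs) = partitionSeries ε b ⊛ coloredSeries b εs

weigh-colored : ∀ b {k} (εs : Vec ℤ k) n →
                weigh (colorWeight εs) (boundedColoredPartitions b k n) ≡ coloredSeries b εs n
weigh-colored b []       zero    = refl
weigh-colored b []       (suc n) = refl
weigh-colored b {suc k} (ε ∷ εs) n =
  trans (total-convolve (colorWeight (ε ∷ εs)) (lengthWeight ε) (colorWeight εs) (λ _ _ → refl) _ _ n)
        (⊛-cong {partitionSeries ε b} (λ _ → refl) (weigh-colored b εs) n)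
  where open Convolution {U = Vec (List ℕ) (suc k)} _∷_

colored⇒bounded : ∀ {b k} {π : Vec (List ℕ) k} → VecAll.All IsPartition π →
                  Vec.sum (Vec.map sum π) ℕ.≤ b → VecAll.All (BoundedPartition b) π
colored⇒bounded []       _   = []
colored⇒bounded (_∷_ {x = π} {xs = πs} p ps) ∑≤b =
  (p , All.map (λ q≤ → ℕ.≤-trans q≤ (ℕ.m+n≤o⇒m≤o (sum π) ∑≤b)) (parts≤sum π)) ∷
  colored⇒bounded ps (ℕ.m+n≤o⇒n≤o (sum π) ∑≤b)

-- The two parity classes of the crank

open import Data.Nat.Base using (_+_; _*_; _≤_; _<_; _>_; _≥_)

A : ℕ → Series
A = partitionSeries -1ℤ

P : ℕ → Series
P = partitionSeries 1ℤ

A-rec : ∀ b → A (suc b) ⊕ X^ (suc b) ⊛ A (suc b) ≗ A b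
A-rec b n = begin
  A (suc b) n ℤ.+ x                 ≡⟨ cong (ℤ._+ x) (partitionSeries-suc -1ℤ b n) ⟩
  A b n ℤ.+ -1ℤ ℤ.* x ℤ.+ x         ≡⟨ ℤ.+-assoc (A b n) (-1ℤ ℤ.* x) x ⟩
  A b n ℤ.+ (-1ℤ ℤ.* x ℤ.+ x)       ≡⟨ cong (λ y → A b n ℤ.+ (y ℤ.+ x)) (ℤ.-1*i≡-i x) ⟩
  A b n ℤ.+ (ℤ.- x ℤ.+ x)           ≡⟨ cong (ℤ._+_ (A b n)) (ℤ.+-inverseˡ x) ⟩
  A b n ℤ.+ 0ℤ                      ≡⟨ ℤ.+-identityʳ (A b n) ⟩
  A b n                             ∎
  where
  open ≡-Reasoning
  x : ℤ
  x = (X^ (suc b) ⊛ A (suc b)) n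

P-rec : ∀ b → P (suc b) ≗ P b ⊕ X^ (suc b) ⊛ P (suc b)
P-rec b n = trans (partitionSeries-suc 1ℤ b n) (cong (ℤ._+_ (P b n)) (ℤ.*-identityˡ _))

open Products A P (partitionSeries-0 -1ℤ) (partitionSeries-0 1ℤ) A-rec P-rec

-- The parity of the crank as a sign

2∣n⊎2∣1+n : ∀ n → 2 ℕ.∣ n ⊎ 2 ℕ.∣ suc n
2∣n⊎2∣1+n zero    = inj₁ (ℕ.divides 0 refl)
2∣n⊎2∣1+n (suc n) = Sum.swap (Sum.map₁ (ℕ.∣m∣n⇒∣m+n ℕ.∣-refl) (2∣n⊎2∣1+n n))

residue-0-or-1 : ∀ i → (i ≡ 0ℤ mod 2) ⊎ (i ≡ 1ℤ mod 2)
residue-0-or-1 (+ n) with 2∣n⊎2∣1+n n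
residue-0-or-1 (+ n)     | inj₁ 2∣n = inj₁ (subst (2 ℕ.∣_) (sym (ℕ.+-identityʳ n)) 2∣n)
residue-0-or-1 (+ zero)  | inj₂ 2∣1 = inj₂ 2∣1
residue-0-or-1 (+ suc n) | inj₂ 2∣2+n = inj₂ (ℕ.∣m+n∣m⇒∣n 2∣2+n ℕ.∣-refl)
-- For i = -(n+1) the absolute values of i - 0 and i - 1 are n+1 and n+2, so the dichotomy is
-- applied to `suc n`.
residue-0-or-1 -[1+ n ]  = Sum.map₂ (subst (λ m → 2 ℕ.∣ suc (suc m)) (sym (ℕ.+-identityʳ n))) (2∣n⊎2∣1+n (suc n))

-1^[2∣] : ∀ {n} → 2 ℕ.∣ n → -1ℤ ℤ.^ n ≡ 1ℤ
-1^[2∣] (ℕ.divides-refl q) = ^-even -1ℤ refl q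

-1^∣i-1∣ : ∀ i → -1ℤ ℤ.^ ∣ i ℤ.- 1ℤ ∣ ≡ -1ℤ ℤ.* -1ℤ ℤ.^ ∣ i ∣
-1^∣i-1∣ (+ zero)  = refl
-1^∣i-1∣ (+ suc n) = trans (sym (ℤ.*-identityˡ _)) (ℤ.*-assoc -1ℤ -1ℤ (-1ℤ ℤ.^ n))
-1^∣i-1∣ -[1+ n ]  = cong (λ m → -1ℤ ℤ.^ suc (suc m)) (ℕ.+-identityʳ n)

-- A difference and a sum have the same parity. This is what splits the sign of the crank into one
-- sign for each of the first two colors.
-1^∣m⊖n∣ : ∀ m n → -1ℤ ℤ.^ ∣ m ℤ.⊖ n ∣ ≡ -1ℤ ℤ.^ m ℤ.* -1ℤ ℤ.^ n
-1^∣m⊖n∣ zero    zero    = refl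
-1^∣m⊖n∣ zero    (suc n) = sym (ℤ.*-identityˡ _)
-1^∣m⊖n∣ (suc m) zero    = sym (ℤ.*-identityʳ _)
-1^∣m⊖n∣ (suc m) (suc n) = begin
  -1ℤ ℤ.^ ∣ suc m ℤ.⊖ suc n ∣                       ≡⟨ cong (λ i → -1ℤ ℤ.^ ∣ i ∣) (ℤ.[1+m]⊖[1+n]≡m⊖n m n) ⟩
  -1ℤ ℤ.^ ∣ m ℤ.⊖ n ∣                               ≡⟨ -1^∣m⊖n∣ m n ⟩
  -1ℤ ℤ.^ m ℤ.* -1ℤ ℤ.^ n                           ≡⟨ ℤ.*-identityˡ _ ⟨
  (-1ℤ ℤ.* -1ℤ) ℤ.* (-1ℤ ℤ.^ m ℤ.* -1ℤ ℤ.^ n)       ≡⟨ ℤ*.interchange -1ℤ -1ℤ (-1ℤ ℤ.^ m) (-1ℤ ℤ.^ n) ⟩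
  -1ℤ ℤ.^ suc m ℤ.* -1ℤ ℤ.^ suc n                   ∎
  where open ≡-Reasoning

residue-0⇒even : ∀ i → i ≡ 0ℤ mod 2 → -1ℤ ℤ.^ ∣ i ∣ ≡ 1ℤ
residue-0⇒even i 2∣i-0 = -1^[2∣] (subst (λ j → 2 ℕ.∣ ∣ j ∣) (ℤ.+-identityʳ i) 2∣i-0)

residue-1⇒odd : ∀ i → i ≡ 1ℤ mod 2 → -1ℤ ℤ.^ ∣ i ∣ ≡ -1ℤ
residue-1⇒odd i 2∣i-1 = begin
  -1ℤ ℤ.^ ∣ i ∣                       ≡⟨ ℤ.*-identityˡ _ ⟨
  (-1ℤ ℤ.* -1ℤ) ℤ.* -1ℤ ℤ.^ ∣ i ∣     ≡⟨ ℤ.*-assoc -1ℤ -1ℤ (-1ℤ ℤ.^ ∣ i ∣) ⟩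
  -1ℤ ℤ.* (-1ℤ ℤ.* -1ℤ ℤ.^ ∣ i ∣)     ≡⟨ cong (-1ℤ ℤ.*_) (-1^∣i-1∣ i) ⟨
  -1ℤ ℤ.* -1ℤ ℤ.^ ∣ i ℤ.- 1ℤ ∣        ≡⟨ cong (-1ℤ ℤ.*_) (-1^[2∣] 2∣i-1) ⟩
  -1ℤ                                 ∎
  where open ≡-Reasoning

crankSigns : ∀ k → Vec ℤ (suc (suc k))
crankSigns k = -1ℤ ∷ -1ℤ ∷ replicate k 1ℤ

colorWeight-1 : ∀ {k} (πs : Vec (List ℕ) k) → colorWeight (replicate k 1ℤ) πs ≡ 1ℤ
colorWeight-1 []       = refl
colorWeight-1 (π ∷ πs) = cong₂ ℤ._*_ (ℤ.^-zeroˡ (length π)) (colorWeight-1 πs)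

colorWeight-crankSigns : ∀ {k} (πs : Vec (List ℕ) (suc (suc k))) →
  colorWeight (crankSigns k) πs ≡ -1ℤ ℤ.^ ∣ kCrank (suc (suc k)) πs ∣
colorWeight-crankSigns (π₁ ∷ π₂ ∷ πs) = begin
  s₁ ℤ.* (s₂ ℤ.* colorWeight (replicate _ 1ℤ) πs)  ≡⟨ cong (λ c → s₁ ℤ.* (s₂ ℤ.* c)) (colorWeight-1 πs) ⟩
  s₁ ℤ.* (s₂ ℤ.* 1ℤ)                               ≡⟨ cong (s₁ ℤ.*_) (ℤ.*-identityʳ s₂) ⟩
  s₁ ℤ.* s₂                                        ≡⟨ -1^∣m⊖n∣ (length π₁) (length π₂) ⟨
  -1ℤ ℤ.^ ∣ length π₁ ℤ.⊖ length π₂ ∣              ≡⟨ cong (λ i → -1ℤ ℤ.^ ∣ i ∣) (ℤ.m-n≡m⊖n (length π₁) (length π₂)) ⟨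
  -1ℤ ℤ.^ ∣ + length π₁ ℤ.- + length π₂ ∣          ∎
  where
  open ≡-Reasoning
  s₁ s₂ : ℤ
  s₁ = -1ℤ ℤ.^ length π₁
  s₂ = -1ℤ ℤ.^ length π₂

-- The two residue classes are disjoint, exhaust the colored partitions of n, and have constant
-- weights 1 and -1. For n ≤ b the bound on parts excludes nothing.
M-difference : ∀ k {b n} → n ≤ b →
  + M (suc (suc k)) 0ℤ 2 n ℤ.- + M (suc (suc k)) 1ℤ 2 n ≡ coloredSeries b (crankSigns k) n
M-difference k {b} {n} n≤b = begin
  + size class₀ ℤ.- + size class₁
    ≡⟨ cong₂ ℤ._+_ (trans (total-const w weight₀) (ℤ.*-identityʳ (+ size class₀)))
                   (trans (total-const w weight₁) (trans (ℤ.*-comm (+ size class₁) -1ℤ) (ℤ.-1*i≡-i (+ size class₁)))) ⟨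
  weigh w class₀ ℤ.+ weigh w class₁
    ≡⟨ total-++ w (elements class₀) (elements class₁) ⟨
  weigh w (∪-enumeration disjoint class₀ class₁)
    ≡⟨ weigh-cong w forget classify (∪-enumeration disjoint class₀ class₁)
         (boundedColoredPartitions b (suc (suc k)) n) ⟩
  weigh w (boundedColoredPartitions b (suc (suc k)) n)
    ≡⟨ weigh-colored b (crankSigns k) n ⟩
  coloredSeries b (crankSigns k) n ∎
  where
  open ≡-Reasoning
  crank  = kCrank (suc (suc k))
  w      = colorWeight (crankSigns k)
  class₀ = crankResidueClass (suc (suc k)) 0ℤ 2 n
  class₁ = crankResidueClass (suc (suc k)) 1ℤ 2 n

  weight₀ : ∀ {πs} → πs ∈ elements class₀ → w πs ≡ 1ℤ
  weight₀ {πs} πs∈ = trans (colorWeight-crankSigns πs) (residue-0⇒even (crank πs) (proj₂ (sound class₀ πs∈)))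

  weight₁ : ∀ {πs} → πs ∈ elements class₁ → w πs ≡ -1ℤ
  weight₁ {πs} πs∈ = trans (colorWeight-crankSigns πs) (residue-1⇒odd (crank πs) (proj₂ (sound class₁ πs∈)))

  disjoint : ∀ {πs} → HasCrankResidue (suc (suc k)) 0ℤ 2 n πs → HasCrankResidue (suc (suc k)) 1ℤ 2 n πs → ⊥
  disjoint {πs} (_ , r₀) (_ , r₁) =
    case trans (sym (residue-0⇒even (crank πs) r₀)) (residue-1⇒odd (crank πs) r₁) of λ ()

  forget : ∀ {πs} → HasCrankResidue (suc (suc k)) 0ℤ 2 n πs ⊎ HasCrankResidue (suc (suc k)) 1ℤ 2 n πs →
           BoundedColoredPartition b (suc (suc k)) n πs
  forget (inj₁ ((ps , refl) , _)) = colored⇒bounded ps n≤b , refl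
  forget (inj₂ ((ps , refl) , _)) = colored⇒bounded ps n≤b , refl

  classify : ∀ {πs} → BoundedColoredPartition b (suc (suc k)) n πs →
             HasCrankResidue (suc (suc k)) 0ℤ 2 n πs ⊎ HasCrankResidue (suc (suc k)) 1ℤ 2 n πs
  classify {πs} (ps , ∑≡n) = Sum.map (colored ,_) (colored ,_) (residue-0-or-1 (crank πs))
    where
    colored : IsColoredPartition (suc (suc k)) n πs
    colored = VecAll.map proj₁ ps , ∑≡n

-- Reading off the inequalities

coloredSeries-2 : ∀ b → coloredSeries b (crankSigns 0) ≗ A b ⊛ A b
coloredSeries-2 b = 𝕊.*-congˡ {A b} (𝕊.*-identityʳ (A b))

coloredSeries-3 : ∀ b → coloredSeries b (crankSigns 1) ≗ A b ⊛ E b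
coloredSeries-3 b = 𝕊.*-congˡ {A b} (𝕊.*-congˡ {A b} (𝕊.*-identityʳ (P b)))

coloredSeries-4+ : ∀ b k → coloredSeries b (crankSigns (suc (suc k))) ≗
                   (E b ⊛ E b) ⊛ coloredSeries b (replicate k 1ℤ)
coloredSeries-4+ b k = solve 3 (λ a p c → a :* (a :* (p :* (p :* c))) := a :* p :* (a :* p) :* c)
  𝕊.refl (A b) (P b) (coloredSeries b (replicate k 1ℤ))
  where
  open SemiringSolver 𝕊.commutativeSemiring using (solve; _:=_; _:*_)

NonNeg-P^ : ∀ b k → NonNeg 1ℤ (coloredSeries b (replicate k 1ℤ))
NonNeg-P^ b zero    = NonNeg-𝟙
NonNeg-P^ b (suc k) = NonNeg-⊛ (NonNeg-P b) (NonNeg-P^ b k)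

PosAt-0-P^ : ∀ b k → PosAt 1ℤ (coloredSeries (suc b) (replicate k 1ℤ)) 0
PosAt-0-P^ b zero    = PosAt-𝟙
PosAt-0-P^ b (suc k) =
  PosAt-⊛ (NonNeg-P (suc b)) (NonNeg-P^ (suc b) k) (PosAt-P b 0) (PosAt-0-P^ b k)

NonNeg-E² : ∀ {e} → e ℤ.* e ≡ 1ℤ → ∀ b → NonNeg e (E b ⊛ E b)
NonNeg-E² e²≡1 b = NonNeg-⊛ (NonNeg-E e²≡1 b) (NonNeg-E e²≡1 b)

0<i-j⇒j<i : ∀ {i j} → 0ℤ ℤ.< i ℤ.- j → j ℤ.< i
0<i-j⇒j<i {i} {j} 0<i-j = begin-strict
  j                  ≡⟨ ℤ.+-identityˡ j ⟨
  0ℤ ℤ.+ j           <⟨ ℤ.+-monoˡ-< j 0<i-j ⟩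
  i ℤ.- j ℤ.+ j      ≡⟨ ℤ.+-assoc i (ℤ.- j) j ⟩
  i ℤ.+ (ℤ.- j ℤ.+ j) ≡⟨ cong (ℤ._+_ i) (ℤ.+-inverseˡ j) ⟩
  i ℤ.+ 0ℤ           ≡⟨ ℤ.+-identityʳ i ⟩
  i                  ∎
  where open ℤ.≤-Reasoning

module _ (k : ℕ) {b : ℕ} {f : Series} (f≗ : coloredSeries b (crankSigns k) ≗ f) where

  private
    K : ℕ
    K = suc (suc k)

    difference : ∀ {n} → n ≤ b → f n ≡ + M K 0ℤ 2 n ℤ.- + M K 1ℤ 2 n
    difference {n} n≤b = sym (trans (M-difference k n≤b) (f≗ n))

  -- Both values of e occur: e = -1 at even indices for k = 2, 3, 4, and e = 1 at every index for k
  -- ≥ 5.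
  M₀>M₁ : ∀ e {n} → e ℤ.^ n ≡ 1ℤ → n ≤ b → PosAt e f n → M K 0ℤ 2 n > M K 1ℤ 2 n
  M₀>M₁ e {n} e^n≡1 n≤b (posAt 0<f) = ℤ.drop‿+<+ (0<i-j⇒j<i (subst (0ℤ ℤ.<_)
    (trans (cong₂ ℤ._*_ e^n≡1 (difference n≤b)) (ℤ.*-identityˡ _)) 0<f))

  M₁>M₀ : ∀ e {n} → e ℤ.^ n ≡ -1ℤ → n ≤ b → PosAt e f n → M K 1ℤ 2 n > M K 0ℤ 2 n
  M₁>M₀ e {n} e^n≡-1 n≤b (posAt 0<f) = ℤ.drop‿+<+ (0<i-j⇒j<i (subst (0ℤ ℤ.<_) (begin
    e ℤ.^ n ℤ.* f n                                 ≡⟨ cong₂ ℤ._*_ e^n≡-1 (difference n≤b) ⟩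
    -1ℤ ℤ.* (+ M K 0ℤ 2 n ℤ.- + M K 1ℤ 2 n)         ≡⟨ ℤ.-1*i≡-i _ ⟩
    ℤ.- (+ M K 0ℤ 2 n ℤ.- + M K 1ℤ 2 n)             ≡⟨ ⁻¹-anti-homo‿- (+ M K 0ℤ 2 n) (+ M K 1ℤ 2 n) ⟩
    + M K 1ℤ 2 n ℤ.- + M K 0ℤ 2 n                   ∎) 0<f))
    where
    open ≡-Reasoning
    open AbelianGroupProperties ℤ.+-0-abelianGroup using (⁻¹-anti-homo‿-)

  -- At such an index the two sign conditions read 0 ≤ f n and 0 ≤ - f n, so the difference of the
  -- two counts is 0.
  M₀≡M₁ : ∀ {n} → -1ℤ ℤ.^ n ≡ -1ℤ → n ≤ b → NonNeg 1ℤ f → NonNeg -1ℤ f → M K 0ℤ 2 n ≡ M K 1ℤ 2 n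
  M₀≡M₁ {n} -1^n≡-1 n≤b (nonNeg 0≤f) (nonNeg 0≤±f) =
    ℤ.+-injective (ℤ.i-j≡0⇒i≡j _ _ (trans (sym (difference n≤b)) (ℤ.≤-antisym f≤0 0≤f[n])))
    where
    0≤f[n] : 0ℤ ℤ.≤ f n
    0≤f[n] = subst (0ℤ ℤ.≤_) (trans (cong (ℤ._* f n) (ℤ.^-zeroˡ n)) (ℤ.*-identityˡ (f n))) (0≤f n)
    f≤0 : f n ℤ.≤ 0ℤ
    f≤0 = ℤ.neg-cancel-≤ (subst (0ℤ ℤ.≤_) (trans (cong (ℤ._* f n) -1^n≡-1) (ℤ.-1*i≡-i (f n))) (0≤±f n))

module _ (n : ℕ) where

  private
    -- The bound 2n + 2 is even, as the factorization of A demands, covers both indices 2n and 2n +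
    -- 1, and is a visible successor, as `PosAt-E` and `PosAt-P` demand.
    t b : ℕ
    t = suc n
    b = t * 2

    even≤b : n * 2 ≤ b
    even≤b = ℕ.m≤n⇒m≤1+n (ℕ.n≤1+n (n * 2))

    odd≤b : suc (n * 2) ≤ b
    odd≤b = ℕ.n≤1+n (suc (n * 2))

    n≤b : n ≤ b
    n≤b = ℕ.≤-trans (ℕ.m≤m*n n 2) even≤b

    -1^even : -1ℤ ℤ.^ (n * 2) ≡ 1ℤ
    -1^even = ^-even -1ℤ refl n

    A-at-0 : PosAt -1ℤ (A b) 0
    A-at-0 = PosAt-A t (PosAt-0-oddProduct t)

    A-at-odd : ∀ {i} → i < t → PosAt -1ℤ (A b) (suc (i * 2))
    A-at-odd i<t = PosAt-A t (PosAt-odd-oddProduct i<t)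

    -- Even coefficients of A may vanish (the one of q² does), so a positive even index is split as
    -- 1 + (2i + 1) into two odd ones; index 0 uses the constant terms.
    A²-at-even : ∀ i → i < t → PosAt -1ℤ (A b ⊛ A b) (i * 2)
    A²-at-even zero    _   = PosAt-⊛ (NonNeg-A t) (NonNeg-A t) A-at-0 A-at-0
    A²-at-even (suc i) 1+i<t =
      PosAt-⊛ (NonNeg-A t) (NonNeg-A t) (A-at-odd (s≤s z≤n)) (A-at-odd {i} (ℕ.<-trans (ℕ.n<1+n i) 1+i<t))

  crank2-even : M 2 0ℤ 2 (n * 2) > M 2 1ℤ 2 (n * 2)
  crank2-even = M₀>M₁ 0 (coloredSeries-2 b) -1ℤ -1^even even≤b (A²-at-even n (ℕ.n<1+n n))

  crank3-even : M 3 0ℤ 2 (n * 2) > M 3 1ℤ 2 (n * 2)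
  crank3-even = M₀>M₁ 1 (coloredSeries-3 b) -1ℤ -1^even even≤b
    (PosAt-⊛ (NonNeg-A t) (NonNeg-E refl b) A-at-0 (PosAt-E refl _ n))

  coloredSeries-4 : coloredSeries b (crankSigns 2) ≗ E b ⊛ E b
  coloredSeries-4 = 𝕊.trans (coloredSeries-4+ b 0) (𝕊.*-identityʳ (E b ⊛ E b))

  crank4-even : M 4 0ℤ 2 (n * 2) > M 4 1ℤ 2 (n * 2)
  crank4-even = M₀>M₁ 2 coloredSeries-4 -1ℤ -1^even even≤b
    (PosAt-⊛ (NonNeg-E refl b) (NonNeg-E refl b) (PosAt-E refl _ 0) (PosAt-E refl _ n))

  crank2-odd : M 2 1ℤ 2 (suc (n * 2)) > M 2 0ℤ 2 (suc (n * 2))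
  crank2-odd = M₁>M₀ 0 (coloredSeries-2 b) -1ℤ (-1^-odd n) odd≤b
    (PosAt-⊛ (NonNeg-A t) (NonNeg-A t) A-at-0 (A-at-odd (ℕ.n<1+n n)))

  crank3-odd : M 3 1ℤ 2 (suc (n * 2)) > M 3 0ℤ 2 (suc (n * 2))
  crank3-odd = M₁>M₀ 1 (coloredSeries-3 b) -1ℤ (-1^-odd n) odd≤b
    -- The index splits as 1 + 2n, since E only has even exponents and A must supply the odd one.
    (PosAt-⊛ (NonNeg-A t) (NonNeg-E refl b) (A-at-odd {0} (s≤s z≤n)) (PosAt-E refl _ n))

  crank4-odd : M 4 0ℤ 2 (suc (n * 2)) ≡ M 4 1ℤ 2 (suc (n * 2))
  crank4-odd = M₀≡M₁ 2 coloredSeries-4 (-1^-odd n) odd≤b (NonNeg-E² refl b) (NonNeg-E² refl b)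

  crank5+ : ∀ k → M (5 + k) 0ℤ 2 n > M (5 + k) 1ℤ 2 n
  crank5+ k = M₀>M₁ (3 + k) (coloredSeries-4+ b (suc k)) 1ℤ (ℤ.^-zeroˡ n) n≤b
    -- One copy of P, available from k = 5 on, supplies the whole index n; `E b ⊛ E b` and the
    -- remaining copies contribute their constant terms.
    (PosAt-⊛ (NonNeg-E² refl b) (NonNeg-P^ b (suc k))
      (PosAt-⊛ (NonNeg-E refl b) (NonNeg-E refl b) (PosAt-E refl _ 0) (PosAt-E refl _ 0))
      (subst (PosAt 1ℤ _) (ℕ.+-identityʳ n)
        (PosAt-⊛ (NonNeg-P b) (NonNeg-P^ b k) (PosAt-P _ n) (PosAt-0-P^ _ k))))

theorem1p4 : (n : ℕ) →
    ( (M 2 0ℤ 2 (2 * n) > M 2 1ℤ 2 (2 * n))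
    × (M 3 0ℤ 2 (2 * n) > M 3 1ℤ 2 (2 * n))
    × (M 4 0ℤ 2 (2 * n) > M 4 1ℤ 2 (2 * n)) )
    ×
    ( (M 2 1ℤ 2 (2 * n + 1) > M 2 0ℤ 2 (2 * n + 1))
    × (M 3 1ℤ 2 (2 * n + 1) > M 3 0ℤ 2 (2 * n + 1)) )
    ×
    (M 4 0ℤ 2 (2 * n + 1) ≡ M 4 1ℤ 2 (2 * n + 1))
    ×
    ((k : ℕ) .{{_ : NonTrivial k}} → k ≥ 5 → M k 0ℤ 2 n > M k 1ℤ 2 n)
theorem1p4 n
  -- The indices are brought to the forms `n * 2` and `suc (n * 2)`; multiplying by 2 on the right
  -- lets `suc n * 2` compute to two successors.
  rewrite ℕ.+-comm (2 * n) 1 | ℕ.*-comm 2 n =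
    (crank2-even n , crank3-even n , crank4-even n)
  , (crank2-odd n , crank3-odd n)
  , crank4-odd n
  , λ { (suc (suc (suc (suc (suc k))))) (s≤s (s≤s (s≤s (s≤s (s≤s z≤n))))) → crank5+ n k }
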